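{- Let $A,B,C$ be finite sets, let $\lambda \in \mathrm{Exch}^\times(2^A,2^B)$, $\mu \in \mathrm{Exch}^\times(2^B,2^C)$, and suppose $\lambda \bullet \mu$ has type $(k,l)$. Then there exist disjoint sets $K,L \subseteq B$ with $|K| =k$, $|L| = l$ such that $$\lambda \bullet \mu = \lambda \circ \theta^{K,L}_B \circ \mu .\qquad (*)$$ Furthermore, if $K,L \subseteq B$ are disjoint with $|K| =k$, $|L| = l$, and $\lambda \circ \theta^{K,L}_B \circ \mu \neq 0_{AC}$, then $(*)$ holds.
   Context: For a finite set $E$, $2^E$ is the set of subsets of $E$. Complements $\overline X$ are taken in the ambient set. $A\sqcup B$ is the disjoint union, and subsets of $A\sqcup B$ are identified with pairs of subsets of $A$ and $B$. $\mathrm{Rel}(2^A,2^B)$ is the set of all binary relations $\lambda \subseteq 2^A\times 2^B$; $X\mapsto_\lambda Y$ means $(X,Y)\in\lambda$; $0_{AB}$ is the empty relation. Composition is in diagrammatic order: $X\mapsto_{\lambda\circ\mu} Z$ iff there is $Y$ with $X\mapsto_\lambda Y$ and $Y\mapsto_\mu Z$. Given $X\mapsto_\lambda Y$ and $u,v\in A\sqcup B$, say $u$ and $v$ are exchangeable in $X\mapsto_\lambda Y$ if either $u=v$, or exactly one of $u,v$ belongs to $\overline X\sqcup Y$ and $X'\mapsto_\lambda Y'$, where $X' = X\,\triangle\,(\{u,v\}\cap A)$ and $Y'=Y\,\triangle\,(\{u,v\}\cap B)$. $\mathrm{Exch}(2^A,2^B)$ is the set of $\lambda\in\mathrm{Rel}(2^A,2^B)$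 such that for all $X\mapsto_\lambda Y$, $X'\mapsto_\lambda Y'$ and all $u\in\overline X\sqcup Y$ there exists $v\in\overline{X'}\sqcup Y'$ such that $u,v$ are exchangeable in $X\mapsto_\lambda Y$. (Equivalently, $\{\overline X\sqcup Y : X\mapsto_\lambda Y\}$ is empty or the set of bases of a matroid on $A\sqcup B$.) $\mathrm{Exch}^\times(2^A,2^B)=\mathrm{Exch}(2^A,2^B)\setminus\{0_{AB}\}$; this is the set of morphisms $A\to B$ of the category $\mathbf{Mtd}^\bullet$, whose composition is $\bullet$. Lax composition. Let $\lambda,\mu$ be non-empty relations in $\mathrm{Rel}(2^A,2^B)$, $\mathrm{Rel}(2^B,2^C)$. For $m\ge 0$, $X\mapsto_{\lambda\bullet_m\mu}Z$ iff there exist $Y,Y'\subseteq B$ with $X\mapsto_\lambda Y'$, $Y\mapsto_\mu Z$, $|Y\triangle Y'|=m$. With $m_0$ the smallest $m$ such that $\lambda\bullet_m\mu\neq 0_{AC}$, $\lambda\bullet\mu:=\lambda\bullet_{m_0}\mu$. For $k,l\ge0$, $X\mapsto_{\lambda\bullet_{k,l}\mu}Z$ iff there exist $Y,Y'\subseteq B$ with $X\mapsto_\lambda Y'$, $Y\mapsto_\mu Z$, $|Y\setminus Y'|=k$, $|Y'\setminus Y|=l$. $\lambda\bullet\mu$ has type $(k_0,l_0)$ if $(k_0,l_0)$ is the unique pair of non-negative integers with $k_0+l_0=m_0$ and $\lambda\bullet_{k_0,l_0}\mu\ne0_{AC}$. Partial identity relation: for disjoint $P,Q\subseteq B$, $\theta^{P,Q}_B\in\mathrm{Rel}(2^B,2^B)$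 is the relation with $X\mapsto Y$ iff $P=Y\setminus X$ and $Q=X\setminus Y$. -}

module Defs where

open import Data.Fin.Base using (Fin)
open import Data.Fin.Subset
open import Data.Nat.Base using (ℕ; _+_; _<_)
open import Data.Product.Base using (_×_; _,_; ∃-syntax; ∃₂)
open import Data.Sum.Base using (_⊎_; inj₁; inj₂)
open import Level using (0ℓ)
open import Relation.Binary.Core using (REL)
open import Relation.Binary.Construct.Composition public
  using () renaming (_;_ to _⨾_)
open import Relation.Binary.Definitions using (NonEmpty)
open import Relation.Binary.PropositionalEquality.Core using (_≡_)
open import Relation.Nullary.Negation.Core using (¬_)

private
  variable
    a b c : ℕ

infixl 5 _△_

_△_ : Subset a → Subset a → Subset a
p △ q = (p ─ q) ∪ (q ─ p)

Disjoint : Subset a → Subset a → Set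
Disjoint p q = Empty (p ∩ q)

-- Finite sets are Fin a, so that 2^A is Subset a.  Relations are Set-valued,
-- and need not be decidable: a subset of the finite set 2^A × 2^B is a
-- relation in Rel2^ a b together with a proof of Decidable.
Rel2^ : ℕ → ℕ → Set₁
Rel2^ a b = REL (Subset a) (Subset b) 0ℓ

-- A subset of A ⊔ B is a pair of subsets of A and of B.

infix 4 _∈⊔_ _∉⊔_

_∈⊔_ : Fin a ⊎ Fin b → Subset a × Subset b → Set
inj₁ i ∈⊔ (S , T) = i ∈ S
inj₂ j ∈⊔ (S , T) = j ∈ T

_∉⊔_ : Fin a ⊎ Fin b → Subset a × Subset b → Set
u ∉⊔ S = ¬ (u ∈⊔ S)

-- {u} ∩ A and {u} ∩ B for u in A ⊔ B.

⁅_⁆₁ : Fin a ⊎ Fin b → Subset a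
⁅ inj₁ i ⁆₁ = ⁅ i ⁆
⁅ inj₂ j ⁆₁ = ⊥

⁅_⁆₂ : Fin a ⊎ Fin b → Subset b
⁅ inj₁ i ⁆₂ = ⊥
⁅ inj₂ j ⁆₂ = ⁅ j ⁆

Exchangeable : Rel2^ a b → Subset a → Subset b →
               Fin a ⊎ Fin b → Fin a ⊎ Fin b → Set
Exchangeable R X Y u v =
  u ≡ v ⊎
  ((u ∈⊔ (∁ X , Y) × v ∉⊔ (∁ X , Y)) ⊎ (u ∉⊔ (∁ X , Y) × v ∈⊔ (∁ X , Y))) ×
  R (X △ (⁅ u ⁆₁ ∪ ⁅ v ⁆₁)) (Y △ (⁅ u ⁆₂ ∪ ⁅ v ⁆₂))

Exch : Rel2^ a b → Set
Exch R = ∀ {X Y X′ Y′} → R X Y → R X′ Y′ →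
         ∀ u → u ∈⊔ (∁ X , Y) →
         ∃[ v ] v ∈⊔ (∁ X′ , Y′) × Exchangeable R X Y u v

Exch× : Rel2^ a b → Set
Exch× R = Exch R × NonEmpty R

infixr 9 _•[_]_ _•⟨_,_⟩_ _•_

_•[_]_ : Rel2^ a b → ℕ → Rel2^ b c → Rel2^ a c
(R •[ m ] S) X Z = ∃₂ λ Y Y′ → R X Y′ × S Y Z × ∣ Y △ Y′ ∣ ≡ m

_•⟨_,_⟩_ : Rel2^ a b → ℕ → ℕ → Rel2^ b c → Rel2^ a c
(R •⟨ k , l ⟩ S) X Z =
  ∃₂ λ Y Y′ → R X Y′ × S Y Z × ∣ Y ─ Y′ ∣ ≡ k × ∣ Y′ ─ Y ∣ ≡ l

IsLeast : Rel2^ a b → Rel2^ b c → ℕ → Set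
IsLeast R S m₀ =
  NonEmpty (R •[ m₀ ] S) × (∀ {m} → m < m₀ → ¬ NonEmpty (R •[ m ] S))

-- There is at most one m₀ with IsLeast R S m₀, so this is R •[ m₀ ] S
-- whenever m₀ exists.
_•_ : Rel2^ a b → Rel2^ b c → Rel2^ a c
(R • S) X Z = ∃[ m₀ ] IsLeast R S m₀ × (R •[ m₀ ] S) X Z

HasType : Rel2^ a b → Rel2^ b c → ℕ → ℕ → Set
HasType R S k₀ l₀ =
  ∃[ m₀ ] IsLeast R S m₀ ×
    (k₀ + l₀ ≡ m₀ × NonEmpty (R •⟨ k₀ , l₀ ⟩ S)) ×
    (∀ {k l} → k + l ≡ m₀ → NonEmpty (R •⟨ k , l ⟩ S) → k ≡ k₀ × l ≡ l₀)

-- Intended for disjoint P and Q; θ P Q is empty otherwise.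
θ : Subset b → Subset b → Rel2^ b b
θ P Q X Y = P ≡ Y ─ X × Q ≡ X ─ Y

{-# OPTIONS --safe #-}

-- Fix an optimal quadruple X₀ ↦ p₀, q₀ ↦ Z₀ with K = q₀ ∖ p₀ and L = p₀ ∖ q₀,
-- and let X ↦ p, q ↦ Z be any other optimal quadruple.  Suppose p and q disagree
-- at some i in a way in which p₀ and q₀ do not, say because p and p₀ differ at i.
-- Exchanging i in X ↦ p with respect to X₀ ↦ p₀ repairs the disagreement at i, so
-- by minimality of ∣ p △ q ∣ the partner must lie in B and create a new one:
-- X is unchanged, the quadruple is still optimal, and p has come closer to p₀.
-- When this stops, q ∖ p ⊆ K and p ∖ q ⊆ L, with equality by counting.
-- As i may have to enter or to leave a basis, the exchange property of the dual
-- matroid is needed as well.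

module Submission where

open import Defs
open import Data.Bool.Base using (Bool; true; false; not)
open import Data.Bool.Properties
  using (not-injective; ¬-not)
  renaming (_≟_ to _≟ᵇ_)
open import Data.Fin.Base using (Fin; zero; suc)
open import Data.Fin.Properties using (any?) renaming (_≟_ to _≟ᶠ_)
open import Data.Fin.Subset using (Subset; ∣_∣; ⊥; ⁅_⁆; ∁; _∪_; _─_; _∈_; _∉_; _⊆_)
open import Data.Fin.Subset.Properties
  using (_∈?_; ∪-comm; ⊆-antisym; p⊆q⇒∣p∣≤∣q∣; p⊂q⇒∣p∣<∣q∣; p─q⊆p;
         x∈p∧x∉q⇒x∈p─q; x∈p∩q⁻)
open import Data.Nat.Base using (ℕ; suc; _+_; _≤_; _<_; s≤s⁻¹)
open import Data.Nat.Properties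
  using (+-suc; +-mono-<-≤; +-monoˡ-<; +-monoʳ-<; suc-injective; n≤1+n;
         ≤-refl; ≤-reflexive; ≤-trans; ≤-antisym; <⇒≱; <⇒≢; ≮⇒≥; module ≤-Reasoning)
open import Data.Product.Base
  using (_×_; _,_; ∃; ∃-syntax; ∃₂; proj₁; proj₂; swap; uncurry)
open import Data.Product.Properties using (×-≡,≡→≡)
open import Data.Sum.Base using (_⊎_; inj₁; inj₂)
open import Data.Sum.Properties using (≡-dec)
open import Data.Vec.Base using ([]; _∷_; there; lookup; updateAt)
open import Data.Vec.Properties
  using ([]=⇒lookup; lookup⇒[]=; lookup-map; lookup∘updateAt; lookup∘updateAt′;
         tabulate∘lookup; tabulate-cong)
open import Function.Base using (_∘_; flip; case_of_)
open import Level using (0ℓ)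
open import Relation.Binary.Core using (REL; _⇔_)
open import Relation.Binary.Definitions
  using (Decidable; DecidableEquality; NonEmpty; nonEmpty)
open import Relation.Binary.PropositionalEquality
  using (_≡_; _≢_; refl; sym; trans; cong; cong₂; subst; subst₂; ≢-sym;
         module ≡-Reasoning)
open import Relation.Nullary
  using (Dec; yes; no; contradiction; ¬?; _×-dec_; _⊎-dec_; map′)
open import Relation.Unary using (Pred) renaming (Decidable to Decidable₁)

private
  variable
    a b c n : ℕ

-- Toggling elements of subsets, and symmetric differences

toggleAt : Fin n → Subset n → Subset n
toggleAt i p = updateAt p i not

lookup-ext : {p q : Subset n} → (∀ i → lookup p i ≡ lookup q i) → p ≡ q
lookup-ext {p = p} {q} eq =
  trans (sym (tabulate∘lookup p)) (trans (tabulate-cong eq) (tabulate∘lookup q))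

△-comm : (p q : Subset n) → p △ q ≡ q △ p
△-comm p q = ∪-comm (p ─ q) (q ─ p)

△-⊥∪⊥ : (p : Subset n) → p △ (⊥ ∪ ⊥) ≡ p
△-⊥∪⊥ []          = refl
△-⊥∪⊥ (true ∷ p)  = cong (true ∷_) (△-⊥∪⊥ p)
△-⊥∪⊥ (false ∷ p) = cong (false ∷_) (△-⊥∪⊥ p)

△-⊥∪⁅⁆ : (i : Fin n) (p : Subset n) → p △ (⊥ ∪ ⁅ i ⁆) ≡ toggleAt i p
△-⊥∪⁅⁆ zero    (true ∷ p)  = cong (false ∷_) (△-⊥∪⊥ p)
△-⊥∪⁅⁆ zero    (false ∷ p) = cong (true ∷_) (△-⊥∪⊥ p)
△-⊥∪⁅⁆ (suc i) (true ∷ p)  = cong (true ∷_) (△-⊥∪⁅⁆ i p)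
△-⊥∪⁅⁆ (suc i) (false ∷ p) = cong (false ∷_) (△-⊥∪⁅⁆ i p)

△-⁅⁆∪⊥ : (i : Fin n) (p : Subset n) → p △ (⁅ i ⁆ ∪ ⊥) ≡ toggleAt i p
△-⁅⁆∪⊥ i p = trans (cong (p △_) (∪-comm ⁅ i ⁆ ⊥)) (△-⊥∪⁅⁆ i p)

-- Distinctness matters: for `i ≡ j` the union of singletons would toggle once, while the two
-- toggles on the right would cancel.
△-⁅⁆∪⁅⁆ : {i j : Fin n} → i ≢ j → (p : Subset n) →
          p △ (⁅ i ⁆ ∪ ⁅ j ⁆) ≡ toggleAt i (toggleAt j p)
△-⁅⁆∪⁅⁆ {i = zero}  {zero}  i≢j p           = contradiction refl i≢j
△-⁅⁆∪⁅⁆ {i = zero}  {suc j} i≢j (true ∷ p)  = cong (false ∷_) (△-⊥∪⁅⁆ j p)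
△-⁅⁆∪⁅⁆ {i = zero}  {suc j} i≢j (false ∷ p) = cong (true ∷_) (△-⊥∪⁅⁆ j p)
△-⁅⁆∪⁅⁆ {i = suc i} {zero}  i≢j (true ∷ p)  = cong (false ∷_) (△-⁅⁆∪⊥ i p)
△-⁅⁆∪⁅⁆ {i = suc i} {zero}  i≢j (false ∷ p) = cong (true ∷_) (△-⁅⁆∪⊥ i p)
△-⁅⁆∪⁅⁆ {i = suc i} {suc j} i≢j (true ∷ p)  =
  cong (true ∷_) (△-⁅⁆∪⁅⁆ (i≢j ∘ cong suc) p)
△-⁅⁆∪⁅⁆ {i = suc i} {suc j} i≢j (false ∷ p) =
  cong (false ∷_) (△-⁅⁆∪⁅⁆ (i≢j ∘ cong suc) p)

x∈p─q⇒x∉q : {x : Fin n} (p q : Subset n) → x ∈ p ─ q → x ∉ q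
x∈p─q⇒x∉q (_ ∷ p) (true ∷ q)  (there x∈) (there x∈q) = x∈p─q⇒x∉q p q x∈ x∈q
x∈p─q⇒x∉q (_ ∷ p) (false ∷ q) (there x∈) (there x∈q) = x∈p─q⇒x∉q p q x∈ x∈q

∣△∣-split : (p q : Subset n) → ∣ p △ q ∣ ≡ ∣ p ─ q ∣ + ∣ q ─ p ∣
∣△∣-split []          []          = refl
∣△∣-split (true ∷ p)  (true ∷ q)  = ∣△∣-split p q
∣△∣-split (true ∷ p)  (false ∷ q) = cong suc (∣△∣-split p q)
∣△∣-split (false ∷ p) (true ∷ q)  =
  trans (cong suc (∣△∣-split p q)) (sym (+-suc _ _))
∣△∣-split (false ∷ p) (false ∷ q) = ∣△∣-split p q

∣△∣-sym : (p q : Subset n) → ∣ p △ q ∣ ≡ ∣ q △ p ∣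
∣△∣-sym p q = cong ∣_∣ (△-comm p q)

∣△∣-toggleAt-≢ : (i : Fin n) (p q : Subset n) → lookup p i ≢ lookup q i →
                 ∣ p △ q ∣ ≡ suc ∣ toggleAt i p △ q ∣
∣△∣-toggleAt-≢ zero (true ∷ p)  (true ∷ q)  p≢q = contradiction refl p≢q
∣△∣-toggleAt-≢ zero (true ∷ p)  (false ∷ q) p≢q = refl
∣△∣-toggleAt-≢ zero (false ∷ p) (true ∷ q)  p≢q = refl
∣△∣-toggleAt-≢ zero (false ∷ p) (false ∷ q) p≢q = contradiction refl p≢q
∣△∣-toggleAt-≢ (suc i) (true ∷ p)  (true ∷ q)  p≢q = ∣△∣-toggleAt-≢ i p q p≢q
∣△∣-toggleAt-≢ (suc i) (true ∷ p)  (false ∷ q) p≢q = cong suc (∣△∣-toggleAt-≢ i p q p≢q)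
∣△∣-toggleAt-≢ (suc i) (false ∷ p) (true ∷ q)  p≢q = cong suc (∣△∣-toggleAt-≢ i p q p≢q)
∣△∣-toggleAt-≢ (suc i) (false ∷ p) (false ∷ q) p≢q = ∣△∣-toggleAt-≢ i p q p≢q

∣△∣-toggleAt-≡ : (i : Fin n) (p q : Subset n) → lookup p i ≡ lookup q i →
                 ∣ toggleAt i p △ q ∣ ≡ suc ∣ p △ q ∣
∣△∣-toggleAt-≡ zero (true ∷ p)  (true ∷ q)  p≡q = refl
∣△∣-toggleAt-≡ zero (false ∷ p) (false ∷ q) p≡q = refl
∣△∣-toggleAt-≡ (suc i) (true ∷ p)  (true ∷ q)  p≡q = ∣△∣-toggleAt-≡ i p q p≡q
∣△∣-toggleAt-≡ (suc i) (true ∷ p)  (false ∷ q) p≡q = cong suc (∣△∣-toggleAt-≡ i p q p≡q)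
∣△∣-toggleAt-≡ (suc i) (false ∷ p) (true ∷ q)  p≡q = cong suc (∣△∣-toggleAt-≡ i p q p≡q)
∣△∣-toggleAt-≡ (suc i) (false ∷ p) (false ∷ q) p≡q = ∣△∣-toggleAt-≡ i p q p≡q

-- Bases on the disjoint union as Boolean functions

Elem : ℕ → ℕ → Set
Elem a b = Fin a ⊎ Fin b

State : ℕ → ℕ → Set
State a b = Subset a × Subset b

private
  variable
    s t : State a b
    u v : Elem a b

infix 4 _≟ᵉ_

_≟ᵉ_ : DecidableEquality (Elem a b)
_≟ᵉ_ = ≡-dec _≟ᶠ_ _≟ᶠ_

anyElem? : {P : Pred (Elem a b) 0ℓ} → Decidable₁ P → Dec (∃ P)
anyElem? P? = map′
  (λ { (inj₁ (i , pi)) → inj₁ i , pi ; (inj₂ (j , pj)) → inj₂ j , pj })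
  (λ { (inj₁ i , pi) → inj₁ (i , pi) ; (inj₂ j , pj) → inj₂ (j , pj) })
  (any? (P? ∘ inj₁) ⊎-dec any? (P? ∘ inj₂))

-- mem (X , Y) is the indicator function of the basis ∁ X ⊔ Y.
mem : State a b → Elem a b → Bool
mem (X , Y) (inj₁ i) = not (lookup X i)
mem (X , Y) (inj₂ j) = lookup Y j

toggle : Elem a b → State a b → State a b
toggle (inj₁ i) (X , Y) = toggleAt i X , Y
toggle (inj₂ j) (X , Y) = X , toggleAt j Y

mem-toggle : ∀ u (s : State a b) → mem (toggle u s) u ≡ not (mem s u)
mem-toggle (inj₁ i) (X , Y) = cong not (lookup∘updateAt i X)
mem-toggle (inj₂ j) (X , Y) = lookup∘updateAt j Y

mem-toggle-≢ : u ≢ v → (s : State a b) → mem (toggle v s) u ≡ mem s u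
mem-toggle-≢ {u = inj₁ i} {inj₁ j} u≢v (X , Y) =
  cong not (lookup∘updateAt′ i j (u≢v ∘ cong inj₁) X)
mem-toggle-≢ {u = inj₁ i} {inj₂ j} u≢v s = refl
mem-toggle-≢ {u = inj₂ i} {inj₁ j} u≢v s = refl
mem-toggle-≢ {u = inj₂ i} {inj₂ j} u≢v (X , Y) =
  lookup∘updateAt′ i j (u≢v ∘ cong inj₂) Y

mem-ext : (∀ u → mem s u ≡ mem t u) → s ≡ t
mem-ext eq = ×-≡,≡→≡
  (lookup-ext (not-injective ∘ eq ∘ inj₁) , lookup-ext (eq ∘ inj₂))

mem⇒∈⊔ : ∀ (s : State a b) u → mem s u ≡ true → u ∈⊔ (∁ (proj₁ s) , proj₂ s)
mem⇒∈⊔ (X , Y) (inj₁ i) eq = lookup⇒[]= i (∁ X) (trans (lookup-map i not X) eq)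
mem⇒∈⊔ (X , Y) (inj₂ j) eq = lookup⇒[]= j Y eq

∈⊔⇒mem : ∀ (s : State a b) u → u ∈⊔ (∁ (proj₁ s) , proj₂ s) → mem s u ≡ true
∈⊔⇒mem (X , Y) (inj₁ i) u∈ = trans (sym (lookup-map i not X)) ([]=⇒lookup u∈)
∈⊔⇒mem (X , Y) (inj₂ j) u∈ = []=⇒lookup u∈

toggle-△ : u ≢ v → (s : State a b) →
           (proj₁ s △ (⁅ u ⁆₁ ∪ ⁅ v ⁆₁) , proj₂ s △ (⁅ u ⁆₂ ∪ ⁅ v ⁆₂)) ≡
           toggle u (toggle v s)
toggle-△ {u = inj₁ i} {inj₁ j} u≢v (X , Y) =
  cong₂ _,_ (△-⁅⁆∪⁅⁆ (u≢v ∘ cong inj₁) X) (△-⊥∪⊥ Y)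
toggle-△ {u = inj₁ i} {inj₂ j} u≢v (X , Y) = cong₂ _,_ (△-⁅⁆∪⊥ i X) (△-⊥∪⁅⁆ j Y)
toggle-△ {u = inj₂ i} {inj₁ j} u≢v (X , Y) = cong₂ _,_ (△-⊥∪⁅⁆ j X) (△-⁅⁆∪⊥ i Y)
toggle-△ {u = inj₂ i} {inj₂ j} u≢v (X , Y) =
  cong₂ _,_ (△-⊥∪⊥ X) (△-⁅⁆∪⁅⁆ (u≢v ∘ cong inj₂) Y)

-- Complementing two sets preserves their symmetric difference, so this is the size of the symmetric
-- difference of the two bases.
distance : State a b → State a b → ℕ
distance (X , Y) (X′ , Y′) = ∣ X △ X′ ∣ + ∣ Y △ Y′ ∣

distance-toggle : ∀ u (s t : State a b) → mem s u ≢ mem t u →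
                  distance s t ≡ suc (distance (toggle u s) t)
distance-toggle (inj₁ i) (X , Y) (X′ , Y′) s≢t =
  cong (_+ ∣ Y △ Y′ ∣) (∣△∣-toggleAt-≢ i X X′ (s≢t ∘ cong not))
distance-toggle (inj₂ j) (X , Y) (X′ , Y′) s≢t =
  trans (cong (∣ X △ X′ ∣ +_) (∣△∣-toggleAt-≢ j Y Y′ s≢t)) (+-suc _ _)

-- Basis exchange for a matroid and its dual

module _ {R : Rel2^ a b} (exch : Exch R) where

  private
    B : State a b → Set
    B = uncurry R

  -- The premise `mem t u ≡ false` excludes the trivial partner `v ≡ u` allowed by `Exchangeable`;
  -- the premise `mem s u ≡ true` excludes the alternative in which `v` leaves and `u` enters.
  exchange-out : B s → B t → ∀ u → mem s u ≡ true → mem t u ≡ false →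
                 ∃[ v ] mem s v ≡ false × mem t v ≡ true × B (toggle u (toggle v s))
  exchange-out {s} {t} Bs Bt u su tu with exch Bs Bt u (mem⇒∈⊔ s u su)
  ... | v , v∈t , inj₁ refl = case trans (sym tu) (∈⊔⇒mem t v v∈t) of λ ()
  ... | v , v∈t , inj₂ (inj₂ (u∉s , _) , _) = contradiction (mem⇒∈⊔ s u su) u∉s
  ... | v , v∈t , inj₂ (inj₁ (_ , v∉s) , r) =
    v , ¬-not (v∉s ∘ mem⇒∈⊔ s v) , ∈⊔⇒mem t v v∈t , subst B (toggle-△ u≢v s) r
    where
    u≢v : u ≢ v
    u≢v refl = v∉s (mem⇒∈⊔ s u su)

  -- The dual exchange property: exchanging from t towards s shrinks t ∖ s to
  -- the single element u, and then the last exchange turns t into s.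
  exchange-in : B s → B t → ∀ u → mem s u ≡ false → mem t u ≡ true →
                ∃[ v ] mem s v ≡ true × mem t v ≡ false × B (toggle u (toggle v s))
  exchange-in {s} {t} Bs Bt u su tu = go (suc (distance t s)) t ≤-refl Bt tu
    where
    -- Only `t` varies; `k` is a strict bound on the distance, so the case of zero is absurd.
    go : ∀ k t → distance t s < k → B t → mem t u ≡ true →
         ∃[ v ] mem s v ≡ true × mem t v ≡ false × B (toggle u (toggle v s))
    go (suc k) t d<k Bt tu
      with anyElem? (λ w → ¬? (w ≟ᵉ u) ×-dec ((mem t w ≟ᵇ true) ×-dec (mem s w ≟ᵇ false)))
    ... | yes (w , w≢u , tw , sw) with exchange-out Bt Bs w tw sw
    ...   | x , tx , sx , Bt₁ =
      let v , sv , t₁v , Bsv = go k t₁ (≤-trans d₁<d (s≤s⁻¹ d<k)) Bt₁ t₁u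
      in v , sv , t₁v⇒tv v sv t₁v , Bsv
      where
      t₁ = toggle w (toggle x t)

      w≢x : w ≢ x
      w≢x refl = case trans (sym tw) tx of λ ()

      u≢x : u ≢ x
      u≢x refl = case trans (sym tu) tx of λ ()

      t₁u : mem t₁ u ≡ true
      t₁u = trans (mem-toggle-≢ (≢-sym w≢u) _) (trans (mem-toggle-≢ u≢x t) tu)

      -- The only element lost on passing from `t` to `t₁` is `w`, which is not in `s`. Hence a
      -- partner found for `t₁` is also one for `t`.
      t₁v⇒tv : ∀ v → mem s v ≡ true → mem t₁ v ≡ false → mem t v ≡ false
      t₁v⇒tv v sv t₁v with v ≟ᵉ x
      ... | yes refl = tx
      ... | no v≢x = trans (sym (trans (mem-toggle-≢ v≢w _) (mem-toggle-≢ v≢x t))) t₁v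
        where
        v≢w : v ≢ w
        v≢w refl = case trans (sym sv) sw of λ ()

      d₁<d : distance t₁ s < distance t s
      d₁<d = begin
        suc (distance t₁ s)           ≡⟨ distance-toggle w (toggle x t) s
                                           (λ eq → case trans (sym sw) (trans (sym eq)
                                             (trans (mem-toggle-≢ w≢x t) tw)) of λ ()) ⟨
        distance (toggle x t) s       ≤⟨ n≤1+n _ ⟩
        suc (distance (toggle x t) s) ≡⟨ distance-toggle x t s
                                           (λ eq → case trans (sym sx) (trans (sym eq) tx) of λ ()) ⟨
        distance t s                  ∎
        where open ≤-Reasoning
    -- Now `u` is the only element of `t` outside `s`. Trading it for some `x` of `s` gives `t₁`
    -- contained in `s`, hence equal to `s`. So `t` itself is `s` with `x` traded for `u`, and `x`
    -- is the partner sought.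
    go (suc k) t d<k Bt tu | no ∄w with exchange-out Bt Bs u tu su
    ... | x , tx , sx , Bt₁ = x , sx , tx , subst B (mem-ext t≗) Bt
      where
      t₁ = toggle u (toggle x t)

      u≢x : u ≢ x
      u≢x refl = case trans (sym tu) tx of λ ()

      t₁⊆s : ∀ w → mem t₁ w ≡ true → mem s w ≡ true
      t₁⊆s w t₁w with w ≟ᵉ u | w ≟ᵉ x
      ... | yes refl | _ =
        case trans (sym t₁w) (trans (mem-toggle u _)
          (cong not (trans (mem-toggle-≢ u≢x t) tu))) of λ ()
      ... | no _ | yes refl = sx
      ... | no w≢u | no w≢x = ¬-not λ sw → ∄w (w , w≢u ,
        trans (sym (trans (mem-toggle-≢ w≢u _) (mem-toggle-≢ w≢x t))) t₁w , sw)

      -- Bases are incomparable: an element of `s` missing from `t₁` could only be exchanged for an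
      -- element of `t₁` outside `s`, and there is none.
      s⊆t₁ : ∀ y → mem s y ≡ true → mem t₁ y ≡ true
      s⊆t₁ y sy = ¬-not λ t₁y → case exchange-out Bs Bt₁ y sy t₁y of
        λ { (v , sv , t₁v , _) → case trans (sym sv) (t₁⊆s v t₁v) of λ () }

      s≗t₁ : ∀ w → mem s w ≡ mem t₁ w
      s≗t₁ w with mem s w in sw | mem t₁ w in t₁w
      ... | true  | _     = trans (sym (s⊆t₁ w sw)) t₁w
      ... | false | true  = trans (sym sw) (t₁⊆s w t₁w)
      ... | false | false = refl

      t≗ : ∀ w → mem t w ≡ mem (toggle u (toggle x s)) w
      t≗ w with w ≟ᵉ u | w ≟ᵉ x
      ... | yes refl | _ = trans tu (sym (trans (mem-toggle u _)
        (cong not (trans (mem-toggle-≢ u≢x s) su))))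
      ... | no w≢u | yes refl = trans tx (sym (trans (mem-toggle-≢ w≢u _)
        (trans (mem-toggle w s) (cong not sx))))
      ... | no w≢u | no w≢x = sym (begin
        mem (toggle u (toggle x s)) w ≡⟨ mem-toggle-≢ w≢u _ ⟩
        mem (toggle x s) w            ≡⟨ mem-toggle-≢ w≢x s ⟩
        mem s w                       ≡⟨ s≗t₁ w ⟩
        mem t₁ w                      ≡⟨ mem-toggle-≢ w≢u _ ⟩
        mem (toggle x t) w            ≡⟨ mem-toggle-≢ w≢x t ⟩
        mem t w                       ∎)
        where open ≡-Reasoning

  -- Both directions in one form. The first inequality lets toggling `v`, like toggling `u`, bring
  -- `s` closer to `t`; the second says that one of `u`, `v` enters the basis as the other leaves.
  exchange : B s → B t → ∀ u → mem s u ≢ mem t u →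
             ∃[ v ] mem s v ≢ mem t v × mem s v ≢ mem s u × B (toggle u (toggle v s))
  exchange {s} {t} Bs Bt u su≢tu with mem s u in su | mem t u in tu
  ... | true  | true  = contradiction refl su≢tu
  ... | false | false = contradiction refl su≢tu
  ... | true  | false with v , sv , tv , r ← exchange-out Bs Bt u su tu
    = v , subst₂ _≢_ (sym sv) (sym tv) (λ ()) , subst (_≢ true) (sym sv) (λ ()) , r
  ... | false | true  with v , sv , tv , r ← exchange-in Bs Bt u su tu
    = v , subst₂ _≢_ (sym sv) (sym tv) (λ ()) , subst (_≢ false) (sym sv) (λ ()) , r

-- Both exchange properties restricted to elements of one side; which element of
-- the other side is exchanged does not matter.
LocalExch : {C : Set} → REL C (Subset b) 0ℓ → Set
LocalExch {C = C} R = ∀ {X X₀ p p₀} → R X p → R X₀ p₀ →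
  ∀ i → lookup p i ≢ lookup p₀ i →
  (∃[ X₁ ] R X₁ (toggleAt i p)) ⊎
  (∃[ j ] lookup p j ≢ lookup p₀ j × lookup p j ≢ lookup p i ×
          R X (toggleAt i (toggleAt j p)))

Exch⇒LocalExch : {R : Rel2^ a b} → Exch R → LocalExch R
Exch⇒LocalExch exch r r₀ i p≢p₀ with exchange exch r r₀ (inj₂ i) p≢p₀
... | inj₁ _ , _ , _ , r₁ = inj₁ (_ , r₁)
... | inj₂ j , p≢p₀ , p≢p , r₁ = inj₂ (j , p≢p₀ , p≢p , r₁)

-- Subsets of the source contribute their complements to a basis, so entering and leaving are
-- swapped. Conditions in the form `≢` survive this swap.
Exch⇒LocalExch-flip : {R : Rel2^ a b} → Exch R → LocalExch (flip R)
Exch⇒LocalExch-flip exch r r₀ i p≢p₀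
  with exchange exch r r₀ (inj₁ i) (p≢p₀ ∘ not-injective)
... | inj₂ _ , _ , _ , r₁ = inj₁ (_ , r₁)
... | inj₁ j , p≢p₀ , p≢p , r₁ = inj₂ (j , p≢p₀ ∘ cong not , p≢p ∘ cong not , r₁)

-- Moving optimal pairs towards a fixed pair

module _ {C D : Set} where

  LowerBound : REL C (Subset b) 0ℓ → REL D (Subset b) 0ℓ → ℕ → Set
  LowerBound R S m = ∀ {X Z p q} → R X p → S Z q → m ≤ ∣ p △ q ∣

  module _ {R : REL C (Subset b) 0ℓ} {S : REL D (Subset b) 0ℓ} {m : ℕ}
           (exchR : LocalExch R) (lower : LowerBound R S m) where

    -- Toggling i resolves a disagreement of p and q, so by minimality the
    -- exchange partner j has to create one, hence p and q agree at j.
    approach : ∀ {X Z X₀ p q p₀} → R X p → S Z q → ∣ p △ q ∣ ≡ m → R X₀ p₀ →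
               ∀ i → lookup p i ≢ lookup q i → lookup p i ≢ lookup p₀ i →
               ∃[ p′ ] R X p′ × ∣ p′ △ q ∣ ≡ m × ∣ p′ △ p₀ ∣ < ∣ p △ p₀ ∣
    approach {p = p} {q} {p₀} r s d≡m r₀ i p≢q p≢p₀ with exchR r r₀ i p≢p₀
    -- A partner on the other side leaves only `i` toggled in `p`, so the distance to `q` would fall
    -- below `m`; `lower` covers every source, hence also `X₁`.
    ... | inj₁ (X₁ , r₁) = contradiction (lower r₁ s)
      (<⇒≱ (≤-reflexive (trans (sym (∣△∣-toggleAt-≢ i p q p≢q)) d≡m)))
    ... | inj₂ (j , pj≢p₀j , pj≢pi , r₁) = p₁ , r₁ , d₁≡m , d₁<d
      where
      p₁ = toggleAt i (toggleAt j p)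

      i≢j : i ≢ j
      i≢j refl = pj≢pi refl

      toggled : lookup (toggleAt j p) i ≡ lookup p i
      toggled = lookup∘updateAt′ i j i≢j p

      step : ∀ q → lookup p i ≢ lookup q i → ∣ toggleAt j p △ q ∣ ≡ suc ∣ p₁ △ q ∣
      step q p≢q = ∣△∣-toggleAt-≢ i (toggleAt j p) q (p≢q ∘ trans (sym toggled))

      d₁<d : ∣ p₁ △ p₀ ∣ < ∣ p △ p₀ ∣
      d₁<d = begin
        suc ∣ p₁ △ p₀ ∣           ≡⟨ step p₀ p≢p₀ ⟨
        ∣ toggleAt j p △ p₀ ∣     ≤⟨ n≤1+n _ ⟩
        suc ∣ toggleAt j p △ p₀ ∣ ≡⟨ ∣△∣-toggleAt-≢ j p p₀ pj≢p₀j ⟨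
        ∣ p △ p₀ ∣                ∎
        where open ≤-Reasoning

      d₁≡m : ∣ p₁ △ q ∣ ≡ m
      d₁≡m with lookup p j ≟ᵇ lookup q j
      ... | yes pj≡qj =
        trans (suc-injective (trans (sym (step q p≢q)) (∣△∣-toggleAt-≡ j p q pj≡qj))) d≡m
      ... | no pj≢qj = contradiction (lower r₁ s) (<⇒≱ (begin
        suc ∣ p₁ △ q ∣            ≡⟨ step q p≢q ⟨
        ∣ toggleAt j p △ q ∣      ≤⟨ n≤1+n _ ⟩
        suc ∣ toggleAt j p △ q ∣  ≡⟨ ∣△∣-toggleAt-≢ j p q pj≢qj ⟨
        ∣ p △ q ∣                 ≡⟨ d≡m ⟩
        m                         ∎))
        where open ≤-Reasoning

LowerBound-sym : {C D : Set} {R : REL C (Subset b) 0ℓ} {S : REL D (Subset b) 0ℓ} {m : ℕ} →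
                 LowerBound R S m → LowerBound S R m
LowerBound-sym {m = m} lower {p = q} {p} s r = subst (m ≤_) (∣△∣-sym p q) (lower r s)

-- Where `p` and `q` agree, they may still differ from `p₀` and `q₀`. Only disagreements are
-- constrained, since only they contribute to the differences to be compared with `K` and `L`.
DisagreesLike : (p q p₀ q₀ : Subset b) → Set
DisagreesLike p q p₀ q₀ =
  ∀ i → lookup p i ≢ lookup q i → lookup p i ≡ lookup p₀ i × lookup q i ≡ lookup q₀ i

module _ {C D : Set} {R : REL C (Subset b) 0ℓ} {S : REL D (Subset b) 0ℓ} {m : ℕ}
         (exchR : LocalExch R) (exchS : LocalExch S) (lower : LowerBound R S m) where

  -- Iterating `approach` on either side lowers the sum of the distances to `p₀` and `q₀`, while
  -- `X`, `Z` and the distance `m` are preserved.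
  align : ∀ {X₀ Z₀ p₀ q₀} → R X₀ p₀ → S Z₀ q₀ →
          ∀ {X Z p q} → R X p → S Z q → ∣ p △ q ∣ ≡ m →
          ∃₂ λ p′ q′ → R X p′ × S Z q′ × ∣ p′ △ q′ ∣ ≡ m × DisagreesLike p′ q′ p₀ q₀
  align {p₀ = p₀} {q₀} r₀ s₀ = go _ ≤-refl
    where
    go : ∀ k {X Z p q} → ∣ p △ p₀ ∣ + ∣ q △ q₀ ∣ < k → R X p → S Z q → ∣ p △ q ∣ ≡ m →
         ∃₂ λ p′ q′ → R X p′ × S Z q′ × ∣ p′ △ q′ ∣ ≡ m × DisagreesLike p′ q′ p₀ q₀
    go (suc k) {p = p} {q} d<k r s d≡m
      with any? (λ i → ¬? (lookup p i ≟ᵇ lookup q i) ×-dec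
                       (¬? (lookup p i ≟ᵇ lookup p₀ i) ⊎-dec ¬? (lookup q i ≟ᵇ lookup q₀ i)))
    ... | yes (i , p≢q , inj₁ p≢p₀) =
      let p₁ , r₁ , d₁≡m , d₁<d = approach {R = R} {S} exchR lower {p = p} {q} {p₀} r s d≡m r₀ i p≢q p≢p₀
      in go k (≤-trans (+-monoˡ-< _ d₁<d) (s≤s⁻¹ d<k)) r₁ s d₁≡m
    ... | yes (i , p≢q , inj₂ q≢q₀) =
      let q₁ , s₁ , d₁≡m , d₁<d =
            approach {R = S} {R} exchS (LowerBound-sym {R = R} {S} lower) {p = q} {p} {q₀}
                     s r (trans (∣△∣-sym q p) d≡m) s₀ i (≢-sym p≢q) q≢q₀
      in go k (≤-trans (+-monoʳ-< _ d₁<d) (s≤s⁻¹ d<k)) r s₁ (trans (∣△∣-sym p q₁) d₁≡m)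
    ... | no ∄i = p , q , r , s , d≡m , agree
      where
      agree : DisagreesLike p q p₀ q₀
      agree i p≢q with lookup p i ≟ᵇ lookup p₀ i | lookup q i ≟ᵇ lookup q₀ i
      ... | yes p≡ | yes q≡ = p≡ , q≡
      ... | no p≢  | _      = contradiction (i , p≢q , inj₁ p≢) ∄i
      ... | yes _  | no q≢  = contradiction (i , p≢q , inj₂ q≢) ∄i

-- From inclusion of differences to equality by counting

DisagreesLike-sym : (p q p₀ q₀ : Subset b) →
                    DisagreesLike p q p₀ q₀ → DisagreesLike q p q₀ p₀
DisagreesLike-sym p q p₀ q₀ like i q≢p = swap (like i (≢-sym q≢p))

DisagreesLike⇒⊆ : (p q p₀ q₀ : Subset b) → DisagreesLike p q p₀ q₀ → p ─ q ⊆ p₀ ─ q₀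
DisagreesLike⇒⊆ p q p₀ q₀ like {x} x∈p─q =
  let p≡p₀ , q≡q₀ = like x (λ p≡q → x∉q (lookup⇒[]= x q (trans (sym p≡q) ([]=⇒lookup x∈p))))
  in x∈p∧x∉q⇒x∈p─q (lookup⇒[]= x _ (trans (sym p≡p₀) ([]=⇒lookup x∈p)))
                    (λ x∈q₀ → x∉q (lookup⇒[]= x q (trans q≡q₀ ([]=⇒lookup x∈q₀))))
  where
  x∈p = p─q⊆p p q x∈p─q

  x∉q : x ∉ q
  x∉q x∈q = x∈p─q⇒x∉q p q x∈p─q x∈q

⊆∧∣∣≥⇒≡ : {p q : Subset n} → p ⊆ q → ∣ q ∣ ≤ ∣ p ∣ → p ≡ q
⊆∧∣∣≥⇒≡ {p = p} {q} p⊆q ∣q∣≤∣p∣ = ⊆-antisym p⊆q q⊆p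
  where
  q⊆p : q ⊆ p
  q⊆p {x} x∈q with x ∈? p
  ... | yes x∈p = x∈p
  ... | no x∉p  = contradiction ∣q∣≤∣p∣ (<⇒≱ (p⊂q⇒∣p∣<∣q∣ (p⊆q , x , x∈q , x∉p)))

-- Each of the two differences is included in its counterpart, and the sizes have equal sums, so
-- neither inclusion can be strict.
DisagreesLike⇒≡ : (p q p₀ q₀ : Subset b) → DisagreesLike p q p₀ q₀ →
                  ∣ p △ q ∣ ≡ ∣ p₀ △ q₀ ∣ → p ─ q ≡ p₀ ─ q₀
DisagreesLike⇒≡ p q p₀ q₀ like d≡d₀ = ⊆∧∣∣≥⇒≡ (DisagreesLike⇒⊆ p q p₀ q₀ like)
  (≮⇒≥ λ ∣p─q∣<∣p₀─q₀∣ → <⇒≢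
    (+-mono-<-≤ ∣p─q∣<∣p₀─q₀∣
      (p⊆q⇒∣p∣≤∣q∣ (DisagreesLike⇒⊆ q p q₀ p₀ (DisagreesLike-sym p q p₀ q₀ like))))
    (trans (sym (∣△∣-split p q)) (trans d≡d₀ (∣△∣-split p₀ q₀))))

-- Lax composition through a partial identity

IsLeast⇒LowerBound : (R : Rel2^ a b) (S : Rel2^ b c) {m : ℕ} →
                     IsLeast R S m → LowerBound R (flip S) m
IsLeast⇒LowerBound R S (_ , least) {p = p} {q} r s =
  ≮⇒≥ λ d<m → least d<m (nonEmpty (q , p , r , s , ∣△∣-sym q p))

IsLeast-≤ : (R : Rel2^ a b) (S : Rel2^ b c) {m m′ : ℕ} →
            IsLeast R S m → IsLeast R S m′ → m ≤ m′
IsLeast-≤ R S (_ , least) (nonempty , _) = ≮⇒≥ λ m′<m → least m′<m nonempty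

-- In a chain through `θ K L`, the sets `K` and `L` are the differences of the middle subsets, so
-- their distance is `m` and the chain is optimal. This gives one inclusion; for the other, a single
-- such chain is the target of `align`.
θ-nonempty⇒•⇔θ : (ƛ : Rel2^ a b) (μ : Rel2^ b c) → Exch ƛ → Exch μ →
  ∀ {m} → IsLeast ƛ μ m → (K L : Subset b) → ∣ K ∣ + ∣ L ∣ ≡ m →
  NonEmpty (ƛ ⨾ θ K L ⨾ μ) → (ƛ • μ) ⇔ (ƛ ⨾ θ K L ⨾ μ)
θ-nonempty⇒•⇔θ ƛ μ exchƛ exchμ {m} least _ _ ∣K∣+∣L∣≡m
  (nonEmpty (p₀ , r₀ , q₀ , (refl , refl) , s₀)) = to , from
  where
  d₀≡m : ∣ p₀ △ q₀ ∣ ≡ m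
  d₀≡m = trans (∣△∣-sym p₀ q₀) (trans (∣△∣-split q₀ p₀) ∣K∣+∣L∣≡m)

  to : ∀ {X Z} → (ƛ • μ) X Z → (ƛ ⨾ θ (q₀ ─ p₀) (p₀ ─ q₀) ⨾ μ) X Z
  to (m′ , least′ , q , p , r , s , d≡m′) =
    let p′ , q′ , r′ , s′ , d′≡m , like =
          -- Reversing `μ` makes the shared set the target of both relations.
          align {R = ƛ} {flip μ} (Exch⇒LocalExch exchƛ) (Exch⇒LocalExch-flip exchμ)
            (IsLeast⇒LowerBound ƛ μ least) r₀ s₀ r s
            (trans (∣△∣-sym p q)
              -- The least value `m′` supplied by `•` coincides with `m`.
              (trans d≡m′ (≤-antisym (IsLeast-≤ ƛ μ least′ least) (IsLeast-≤ ƛ μ least least′))))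
        d′≡d₀ = trans d′≡m (sym d₀≡m)
    in p′ , r′ , q′ ,
       (sym (DisagreesLike⇒≡ q′ p′ q₀ p₀ (DisagreesLike-sym p′ q′ p₀ q₀ like)
              (trans (∣△∣-sym q′ p′) (trans d′≡d₀ (∣△∣-sym p₀ q₀)))) ,
        sym (DisagreesLike⇒≡ p′ q′ p₀ q₀ like d′≡d₀)) ,
       s′

  from : ∀ {X Z} → (ƛ ⨾ θ (q₀ ─ p₀) (p₀ ─ q₀) ⨾ μ) X Z → (ƛ • μ) X Z
  from (p , r , q , (K≡ , L≡) , s) = m , least , q , p , r , s ,
    trans (∣△∣-split q p)
      (trans (sym (cong₂ (λ K L → ∣ K ∣ + ∣ L ∣) K≡ L≡)) ∣K∣+∣L∣≡m)

─-Disjoint : (p q : Subset n) → Disjoint (p ─ q) (q ─ p)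
─-Disjoint p q (x , x∈) =
  let x∈p─q , x∈q─p = x∈p∩q⁻ _ _ x∈
  in x∈p─q⇒x∉q p q x∈p─q (p─q⊆p q p x∈q─p)

theorem7p1 : ∀ {a b c : ℕ} (ƛ : Rel2^ a b) (μ : Rel2^ b c) →
    Decidable ƛ → Decidable μ →
    Exch× ƛ → Exch× μ →
    ∀ (k l : ℕ) → HasType ƛ μ k l →
    (∃₂ λ (K L : Subset b) →
    Disjoint K L × ∣ K ∣ ≡ k × ∣ L ∣ ≡ l × ((ƛ • μ) ⇔ (ƛ ⨾ θ K L ⨾ μ)))
    ×
    (∀ (K L : Subset b) →
    Disjoint K L → ∣ K ∣ ≡ k → ∣ L ∣ ≡ l →
    NonEmpty (ƛ ⨾ θ K L ⨾ μ) →
    (ƛ • μ) ⇔ (ƛ ⨾ θ K L ⨾ μ))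
theorem7p1 ƛ μ _ _ (exchƛ , _) (exchμ , _) k l
  (m , least , (k+l≡m , nonEmpty (q , p , r , s , ∣K∣≡k , ∣L∣≡l)) , _) =
  -- `K` and `L` are read off a quadruple realising the type. It also witnesses non-emptiness, so
  -- the first claim becomes an instance of the second.
  (q ─ p , p ─ q , ─-Disjoint q p , ∣K∣≡k , ∣L∣≡l ,
   equal _ _ ∣K∣≡k ∣L∣≡l (nonEmpty (p , r , q , (refl , refl) , s))) ,
  λ K L _ → equal K L
  where
  equal : ∀ K L → ∣ K ∣ ≡ k → ∣ L ∣ ≡ l → NonEmpty (ƛ ⨾ θ K L ⨾ μ) →
          (ƛ • μ) ⇔ (ƛ ⨾ θ K L ⨾ μ)
  equal K L ∣K∣≡k ∣L∣≡l =
    θ-nonempty⇒•⇔θ ƛ μ exchƛ exchμ least K L (trans (cong₂ _+_ ∣K∣≡k ∣L∣≡l) k+l≡m)
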